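{- Let $L$ be an $r\times n$ $\boldsymbol\rho$-latin rectangle with $r<n$. Then $L$ can be completed to an $n\times n$ $\boldsymbol\rho$-latin square if and only if $\rho_\ell-e_\ell\le n-r$ for all $\ell\in[k]$ and one (equivalently, given the first condition, every one) of the following six conditions holds: (1) $|J|(n-r)\le\sum_{\ell\in[k]}\min\{\rho_\ell-e_\ell,\ \mu_J(\ell)\}$ for all $J\subseteq[n]$; (2) $\sum_{\ell\in K}(\rho_\ell-e_\ell)\le\sum_{j\in[n]}\min\{n-r,\ \mu_K(j)\}$ for all $K\subseteq[k]$; (3) $|J|(n-r)\ge\sum_{\ell\in[k]}\big((\rho_\ell-e_\ell)\dot-\mu_{\bar J}(\ell)\big)$ for all $J\subseteq[n]$; (4) $\sum_{\ell\in K}(\rho_\ell-e_\ell)\ge\sum_{j\in[n]}\big((n-r)\dot-\mu_{\bar K}(j)\big)$ for all $K\subseteq[k]$; (5) $|J|(n-r)\le\sum_{\ell\in K}(\rho_\ell-e_\ell)+\mu_J(\bar K)$ for all $J\subseteq[n]$ and $K\subseteq[k]$; (6) $\sum_{\ell\in K}(\rho_\ell-e_\ell)\le|J|(n-r)+\mu_K(\bar J)$ for all $J\subseteq[n]$ and $K\subseteq[k]$.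
   Context: Let $n,k$ be positive integers. Let $\boldsymbol\rho=(\rho_1,\dots,\rho_k)$ be integers with $1\le\rho_\ell\le n\le k$ and $\sum_{\ell\in[k]}\rho_\ell=n^2$. The symbols are the elements of $[k]$. A $\boldsymbol\rho$-latin square of order $n$ is an $n\times n$ array with entries in $[k]$, each symbol at most once per row and per column, and symbol $\ell$ occurring exactly $\rho_\ell$ times. An $r\times s$ $\boldsymbol\rho$-latin rectangle is an $r\times s$ array with entries in $[k]$, each symbol at most once per row and per column, and symbol $\ell$ occurring at most $\rho_\ell$ times. Completing it means finding a $\boldsymbol\rho$-latin square of order $n$ whose top-left subarray is $L$. Here $s=n$, so the columns are $[n]$. $e_\ell$ is the number of occurrences of $\ell$ in $L$. For $j\in[n]$, $\ell\in[k]$, $J\subseteq[n]$, $K\subseteq[k]$: - $\mu_K(j)$ is the number of symbols of $K$ not occurring in column $j$ of $L$; - $\mu_J(\ell)$ is the number of columns in $J$ not containing $\ell$; - $\mu_J(K)=\sum_{\ell\in K}\mu_J(\ell)$ and $\mu_K(J)=\sum_{j\in J}\mu_K(j)$. $\bar J=[n]\setminus J$, $\bar K=[k]\setminus K$, and $x\dot- y=\max\{0,x-y\}$. -}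

module Defs where

open import Data.Bool.Base using (if_then_else_)
open import Data.Fin.Base using (Fin; inject≤)
open import Data.Fin.Patterns using (0F; 1F; 2F; 3F; 4F; 5F)
open import Data.Fin.Properties using (_≟_; any?)
open import Data.Fin.Subset using (Subset; ∁; ∣_∣)
open import Data.Fin.Subset.Properties using (_∈?_)
open import Data.Nat.Base using (ℕ; _+_; _*_; _∸_; _^_; _⊓_; _≤_; _≥_)
open import Data.Nat.Properties using (+-*-semiring)
open import Data.Product.Base using (∃; ∃-syntax; _×_)
open import Function.Definitions using (Injective)
open import Relation.Binary.PropositionalEquality.Core using (_≡_)
open import Relation.Nullary using (Dec; does; ¬?; _×-dec_)
open import Algebra.Properties.Semiring.Sum +-*-semiring using (sum-syntax)

private
  variable
    n k r s : ℕ

-- Symbols, rows and columns are indexed from 0: [k] is Fin k.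
Array : ℕ → ℕ → ℕ → Set
Array r s k = Fin r → Fin s → Fin k

count : {P : Fin n → Set} → (∀ i → Dec (P i)) → ℕ
count {n} P? = ∑[ i < n ] (if does (P? i) then 1 else 0)

sumOver : Subset n → (Fin n → ℕ) → ℕ
sumOver {n} S f = ∑[ i < n ] (if does (i ∈? S) then f i else 0)

record Admissible (n k : ℕ) (ρ : Fin k → ℕ) : Set where
  field
    n-positive : 1 ≤ n
    k-positive : 1 ≤ k
    ρ-positive : ∀ ℓ → 1 ≤ ρ ℓ
    ρ≤n        : ∀ ℓ → ρ ℓ ≤ n
    n≤k        : n ≤ k
    ρ-sum      : ∑[ ℓ < k ] ρ ℓ ≡ n ^ 2

occurrences : Array r s k → Fin k → ℕ
occurrences {r} L ℓ = ∑[ i < r ] count (λ j → L i j ≟ ℓ)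

record IsLatin (L : Array r s k) : Set where
  field
    rows    : ∀ i → Injective _≡_ _≡_ (λ j → L i j)
    columns : ∀ j → Injective _≡_ _≡_ (λ i → L i j)

record IsLatinRectangle (ρ : Fin k → ℕ) (L : Array r s k) : Set where
  field
    isLatin : IsLatin L
    atMost  : ∀ ℓ → occurrences L ℓ ≤ ρ ℓ

record IsLatinSquare (ρ : Fin k → ℕ) (M : Array n n k) : Set where
  field
    isLatin : IsLatin M
    exactly : ∀ ℓ → occurrences M ℓ ≡ ρ ℓ

Completable : (ρ : Fin k → ℕ) → r ≤ n → s ≤ n → Array r s k → Set
Completable {k} {r} {n} {s} ρ r≤n s≤n L =
  ∃[ M ] IsLatinSquare {k} {n} ρ M ×
         (∀ i j → M (inject≤ i r≤n) (inject≤ j s≤n) ≡ L i j)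

InColumn : Array r n k → Fin k → Fin n → Set
InColumn L ℓ j = ∃ λ i → L i j ≡ ℓ

inColumn? : (L : Array r n k) (ℓ : Fin k) (j : Fin n) → Dec (InColumn L ℓ j)
inColumn? L ℓ j = any? (λ i → L i j ≟ ℓ)

module Conditions {r n k : ℕ} (ρ : Fin k → ℕ) (L : Array r n k) where

  -- μ_K(j)
  μₖ : Subset k → Fin n → ℕ
  μₖ K j = count (λ ℓ → (ℓ ∈? K) ×-dec ¬? (inColumn? L ℓ j))

  -- μ_J(ℓ)
  μⱼ : Subset n → Fin k → ℕ
  μⱼ J ℓ = count (λ j → (j ∈? J) ×-dec ¬? (inColumn? L ℓ j))

  -- ρ_ℓ − e_ℓ.  Truncation never takes effect when L is a ρ-latin rectangle,
  -- since then e_ℓ ≤ ρ_ℓ; likewise for n ∸ r below when r < n.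
  deficit : Fin k → ℕ
  deficit ℓ = ρ ℓ ∸ occurrences L ℓ

  DeficitBound : Set
  DeficitBound = ∀ ℓ → deficit ℓ ≤ n ∸ r

  -- In cases 2F and 3F the outer ∸ is the genuine operation max{0, x − y}.
  -- In cases 4F and 5F the last summands are μ_J(K̄) and μ_K(J̄).
  Condition : Fin 6 → Set
  Condition 0F = ∀ (J : Subset n) →
    ∣ J ∣ * (n ∸ r) ≤ ∑[ ℓ < k ] (deficit ℓ ⊓ μⱼ J ℓ)
  Condition 1F = ∀ (K : Subset k) →
    sumOver K deficit ≤ ∑[ j < n ] ((n ∸ r) ⊓ μₖ K j)
  Condition 2F = ∀ (J : Subset n) →
    ∣ J ∣ * (n ∸ r) ≥ ∑[ ℓ < k ] (deficit ℓ ∸ μⱼ (∁ J) ℓ)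
  Condition 3F = ∀ (K : Subset k) →
    sumOver K deficit ≥ ∑[ j < n ] ((n ∸ r) ∸ μₖ (∁ K) j)
  Condition 4F = ∀ (J : Subset n) (K : Subset k) →
    ∣ J ∣ * (n ∸ r) ≤ sumOver K deficit + sumOver (∁ K) (μⱼ J)
  Condition 5F = ∀ (J : Subset n) (K : Subset k) →
    sumOver K deficit ≤ ∣ J ∣ * (n ∸ r) + sumOver (∁ J) (μₖ K)

{-# OPTIONS --safe #-}
-- The remaining n ∸ r rows amount to a bipartite graph between columns and symbols
-- in which every column has degree n ∸ r and symbol ℓ has degree ρ_ℓ − e_ℓ, using
-- only pairs (j, ℓ) with ℓ absent from column j, together with an edge colouring by
-- n ∸ r colours, the new rows. Condition (5) is the cut condition for such a graph,
-- viewed as an integral transportation problem, and the other five are restatements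
-- of it by optimising over one side of the cut or complementing. The colouring needs
-- all degrees at most n ∸ r; it comes from the same transportation theorem, applied
-- to round 1/(n ∸ r) times the current matrix down to an integral matrix.
module Submission where

open import Defs
open import Data.Bool.Base using (Bool; true; false; T; not; _∧_; _∨_; if_then_else_)
open import Data.Bool.Properties using (if-∧; ∨-identityʳ; ∨-zeroʳ; ∧-identityʳ; ∧-zeroʳ)
open import Data.Fin.Patterns using (0F; 1F; 2F; 3F; 4F; 5F)
open import Data.Fin.Base using (Fin; zero; suc; inject≤; splitAt; _↑ˡ_; _↑ʳ_)
open import Data.Fin.Properties using (_≟_; any?; suc-injective; inject≤-refl; splitAt-↑ˡ; splitAt-↑ʳ; toℕ-injective; toℕ-inject≤; toℕ-↑ˡ)
open import Data.Fin.Subset using (Subset; ∁; ∣_∣; ⊤; ⊥; _∪_; _∩_; inside; outside)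
open import Data.Fin.Subset.Properties using (_∈?_; anySubset?)
open import Data.Nat.Base using (ℕ; zero; suc; _+_; _*_; _∸_; _⊓_; _≤_; _<_; _≤ᵇ_; _^_; z≤n)
open import Data.Nat.Properties hiding (_≟_; suc-injective)
open import Algebra.Properties.Semiring.Sum +-*-semiring
  using (sum; sum-syntax; sum-cong-≗; ∑-distrib-+; ∑-comm; *-distribˡ-sum; sum-replicate-zero)
open import Data.Nat.Tactic.RingSolver using (solve-∀)
open import Data.Product.Base using (∃-syntax; Σ-syntax; _×_; _,_; proj₁; proj₂)
open import Data.Vec.Base using ([]; _∷_; tabulate; _[_]≔_)
open import Data.Vec.Properties using (map-[]≔)
open import Data.Sum.Base using ([_,_]′; inj₁; inj₂)
open import Function.Base using (_∘_; flip)
open import Function.Definitions using (Injective)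
open import Function.Bundles using (_⇔_; mk⇔; module Equivalence)
open import Function.Construct.Composition using (_⇔-∘_)
open import Relation.Binary.PropositionalEquality
  using (_≡_; _≢_; refl; sym; trans; cong; cong₂; subst; subst₂; module ≡-Reasoning)
open import Relation.Nullary using (Dec; does; yes; no; contradiction)

open Conditions using (deficit)

private
  variable
    p q r m n k : ℕ

-- Sums of natural numbers

sum-mono : {f g : Fin p → ℕ} → (∀ i → f i ≤ g i) → sum f ≤ sum g
sum-mono {zero}  f≤g = z≤n
sum-mono {suc p} f≤g = +-mono-≤ (f≤g zero) (sum-mono (f≤g ∘ suc))

term≤sum : (f : Fin p → ℕ) (i : Fin p) → f i ≤ sum f
term≤sum f zero    = m≤m+n _ _
term≤sum f (suc i) = ≤-trans (term≤sum (f ∘ suc) i) (m≤n+m _ _)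

sum-zero : {f : Fin p → ℕ} → (∀ i → f i ≡ 0) → sum f ≡ 0
sum-zero {p} f≗0 = trans (sum-cong-≗ f≗0) (sum-replicate-zero p)

sum-const : ∀ p m → ∑[ i < p ] m ≡ p * m
sum-const zero    m = refl
sum-const (suc p) m = cong (m +_) (sum-const p m)

-- Indicators, and membership as a boolean

𝟙 : Subset p → Fin p → ℕ
𝟙 S i = if does (i ∈? S) then 1 else 0

-- This has the shape of the summand in `count`, so that `occurrences L ℓ` is by definition the
-- double sum of `δ (L i j) ℓ`.
δ : Fin p → Fin p → ℕ
δ i i′ = if does (i ≟ i′) then 1 else 0

∈?-∁ : (S : Subset p) (i : Fin p) → does (i ∈? ∁ S) ≡ not (does (i ∈? S))
∈?-∁ (inside  ∷ S) zero    = refl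
∈?-∁ (outside ∷ S) zero    = refl
∈?-∁ (s       ∷ S) (suc i) = ∈?-∁ S i

∈?-∪ : (S T : Subset p) (i : Fin p) → does (i ∈? (S ∪ T)) ≡ does (i ∈? S) ∨ does (i ∈? T)
∈?-∪ (inside  ∷ S) (t       ∷ T) zero    = refl
∈?-∪ (outside ∷ S) (inside  ∷ T) zero    = refl
∈?-∪ (outside ∷ S) (outside ∷ T) zero    = refl
∈?-∪ (s       ∷ S) (t       ∷ T) (suc i) = ∈?-∪ S T i

∈?-∩ : (S T : Subset p) (i : Fin p) → does (i ∈? (S ∩ T)) ≡ does (i ∈? S) ∧ does (i ∈? T)
∈?-∩ (inside  ∷ S) (inside  ∷ T) zero    = refl
∈?-∩ (inside  ∷ S) (outside ∷ T) zero    = refl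
∈?-∩ (outside ∷ S) (t       ∷ T) zero    = refl
∈?-∩ (s       ∷ S) (t       ∷ T) (suc i) = ∈?-∩ S T i

∈?-tabulate : (f : Fin p → Bool) (i : Fin p) → does (i ∈? tabulate f) ≡ f i
∈?-tabulate f zero with f zero
... | true  = refl
... | false = refl
∈?-tabulate f (suc i) = ∈?-tabulate (f ∘ suc) i

∈?-≔ : (S : Subset p) (i : Fin p) (b : Bool) → does (i ∈? (S [ i ]≔ b)) ≡ b
∈?-≔ (s ∷ S) zero    true  = refl
∈?-≔ (s ∷ S) zero    false = refl
∈?-≔ (s ∷ S) (suc i) b     = ∈?-≔ S i b

∁-involutive : (S : Subset p) → ∁ (∁ S) ≡ S
∁-involutive []            = refl
∁-involutive (inside  ∷ S) = cong (inside ∷_) (∁-involutive S)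
∁-involutive (outside ∷ S) = cong (outside ∷_) (∁-involutive S)

-- Sums over subsets

sumOver-cong : (S : Subset p) {f g : Fin p → ℕ} → (∀ i → f i ≡ g i) → sumOver S f ≡ sumOver S g
sumOver-cong S f≗g = sum-cong-≗ λ i → cong (if does (i ∈? S) then_else 0) (f≗g i)

sumOver-mono : (S : Subset p) {f g : Fin p → ℕ} → (∀ i → f i ≤ g i) → sumOver S f ≤ sumOver S g
sumOver-mono S f≤g = sum-mono λ i → termwise (does (i ∈? S)) (f≤g i)
  where
  termwise : ∀ b {m n} → m ≤ n → (if b then m else 0) ≤ (if b then n else 0)
  termwise true  m≤n = m≤n
  termwise false m≤n = z≤n

sumOver≤sum : (S : Subset p) (f : Fin p → ℕ) → sumOver S f ≤ sum f
sumOver≤sum S f = sum-mono λ i → termwise (does (i ∈? S))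
  where
  termwise : ∀ b {m} → (if b then m else 0) ≤ m
  termwise true  = ≤-refl
  termwise false = z≤n

sumOver-zero : (S : Subset p) {f : Fin p → ℕ} → (∀ i → f i ≡ 0) → sumOver S f ≡ 0
sumOver-zero S {f} f≗0 = n≤0⇒n≡0 (≤-trans (sumOver≤sum S f) (≤-reflexive (sum-zero f≗0)))

sumOver-⊤ : (f : Fin p → ℕ) → sumOver ⊤ f ≡ sum f
sumOver-⊤ {zero}  f = refl
sumOver-⊤ {suc p} f = cong (f zero +_) (sumOver-⊤ (f ∘ suc))

sumOver-⊥ : (f : Fin p → ℕ) → sumOver ⊥ f ≡ 0
sumOver-⊥ {zero}  f = refl
sumOver-⊥ {suc p} f = sumOver-⊥ (f ∘ suc)

sumOver-const : (S : Subset p) (m : ℕ) → sumOver S (λ _ → m) ≡ ∣ S ∣ * m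
sumOver-const []            m = refl
sumOver-const (inside  ∷ S) m = cong (m +_) (sumOver-const S m)
sumOver-const (outside ∷ S) m = sumOver-const S m

sumOver-*ˡ : (S : Subset p) (m : ℕ) (f : Fin p → ℕ) → sumOver S (λ i → m * f i) ≡ m * sumOver S f
sumOver-*ˡ []            m f = sym (*-zeroʳ m)
sumOver-*ˡ (inside  ∷ S) m f =
  trans (cong (m * f zero +_) (sumOver-*ˡ S m (f ∘ suc))) (sym (*-distribˡ-+ m (f zero) _))
sumOver-*ˡ (outside ∷ S) m f = sumOver-*ˡ S m (f ∘ suc)

sumOver-split : (S : Subset p) (f g : Fin p → ℕ) →
  ∑[ i < p ] (if does (i ∈? S) then f i else g i) ≡ sumOver S f + sumOver (∁ S) g
sumOver-split {p} S f g = begin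
  ∑[ i < p ] (if does (i ∈? S) then f i else g i)
    ≡⟨ sum-cong-≗ (λ i → trans (termwise (does (i ∈? S)))
         (cong (λ b → (if does (i ∈? S) then f i else 0) + (if b then g i else 0)) (sym (∈?-∁ S i)))) ⟩
  ∑[ i < p ] ((if does (i ∈? S) then f i else 0) + (if does (i ∈? ∁ S) then g i else 0))
    ≡⟨ ∑-distrib-+ (λ i → if does (i ∈? S) then f i else 0) _ ⟩
  sumOver S f + sumOver (∁ S) g ∎
  where
  open ≡-Reasoning
  termwise : ∀ b {x y} → (if b then x else y) ≡ (if b then x else 0) + (if not b then y else 0)
  termwise true  = sym (+-identityʳ _)
  termwise false = refl

sumOver-∁ : (S : Subset p) (f : Fin p → ℕ) → sumOver S f + sumOver (∁ S) f ≡ sum f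
sumOver-∁ S f = trans (sym (sumOver-split S f f)) (sum-cong-≗ λ i → if-idem (does (i ∈? S)))
  where
  if-idem : ∀ b {x : ℕ} → (if b then x else x) ≡ x
  if-idem true  = refl
  if-idem false = refl

sumOver-∑ : (S : Subset p) (f : Fin p → Fin q → ℕ) →
  sumOver S (λ i → ∑[ j < q ] f i j) ≡ ∑[ j < q ] sumOver S (λ i → f i j)
sumOver-∑ {p} {q} S f =
  trans (sum-cong-≗ λ i → distrib (does (i ∈? S)) (f i))
        (∑-comm (λ i j → if does (i ∈? S) then f i j else 0))
  where
  distrib : ∀ b (g : Fin q → ℕ) → (if b then sum g else 0) ≡ ∑[ j < q ] (if b then g j else 0)
  distrib true  g = refl
  distrib false g = sym (sum-replicate-zero q)

sumOver-comm : (S : Subset p) (T : Subset q) (f : Fin p → Fin q → ℕ) →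
  sumOver S (λ i → sumOver T (f i)) ≡ sumOver T (λ j → sumOver S (λ i → f i j))
sumOver-comm S T f =
  trans (sumOver-∑ S (λ i j → if does (j ∈? T) then f i j else 0))
        (sum-cong-≗ λ j → pull (does (j ∈? T)) (λ i → f i j))
  where
  pull : ∀ b g → sumOver S (λ i → if b then g i else 0) ≡ (if b then sumOver S g else 0)
  pull true  g = refl
  pull false g = sumOver-zero S (λ _ → refl)

sumOver-∪∩ : (S T : Subset p) (f : Fin p → ℕ) →
  sumOver (S ∪ T) f + sumOver (S ∩ T) f ≡ sumOver S f + sumOver T f
sumOver-∪∩ {p} S T f = begin
  sumOver (S ∪ T) f + sumOver (S ∩ T) f
    ≡⟨ ∑-distrib-+ (λ i → if does (i ∈? (S ∪ T)) then f i else 0) _ ⟨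
  ∑[ i < p ] ((if does (i ∈? (S ∪ T)) then f i else 0) + (if does (i ∈? (S ∩ T)) then f i else 0))
    ≡⟨ sum-cong-≗ (λ i → trans
         (cong₂ (λ b c → (if b then f i else 0) + (if c then f i else 0)) (∈?-∪ S T i) (∈?-∩ S T i))
         (termwise (does (i ∈? S)) (does (i ∈? T)))) ⟩
  ∑[ i < p ] ((if does (i ∈? S) then f i else 0) + (if does (i ∈? T) then f i else 0))
    ≡⟨ ∑-distrib-+ (λ i → if does (i ∈? S) then f i else 0) _ ⟩
  sumOver S f + sumOver T f ∎
  where
  open ≡-Reasoning
  termwise : ∀ b c {x} → (if b ∨ c then x else 0) + (if b ∧ c then x else 0) ≡
                         (if b then x else 0) + (if c then x else 0)
  termwise true  c = refl
  termwise false c = +-identityʳ _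

sumOver-∩ˡ : (S T : Subset p) (f : Fin p → ℕ) → sumOver (S ∩ T) f ≤ sumOver S f
sumOver-∩ˡ S T f = sum-mono λ i →
  ≤-trans (≤-reflexive (cong (if_then f i else 0) (∈?-∩ S T i)))
          (termwise (does (i ∈? S)) (does (i ∈? T)))
  where
  termwise : ∀ b c {x} → (if b ∧ c then x else 0) ≤ (if b then x else 0)
  termwise true  true  = ≤-refl
  termwise true  false = z≤n
  termwise false c     = z≤n

sumOver-∩ʳ : (S T : Subset p) (f : Fin p → ℕ) → sumOver (S ∩ T) f ≤ sumOver T f
sumOver-∩ʳ S T f = +-cancelˡ-≤ (sumOver S f) _ _ (begin
  sumOver S f + sumOver (S ∩ T) f       ≤⟨ +-monoˡ-≤ _ (sumOver-∪ S T f) ⟩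
  sumOver (S ∪ T) f + sumOver (S ∩ T) f ≡⟨ sumOver-∪∩ S T f ⟩
  sumOver S f + sumOver T f             ∎)
  where
  open ≤-Reasoning
  termwise : ∀ b c {x} → (if b then x else 0) ≤ (if b ∨ c then x else 0)
  termwise true  c = ≤-refl
  termwise false c = z≤n
  sumOver-∪ : (S T : Subset p) (f : Fin p → ℕ) → sumOver S f ≤ sumOver (S ∪ T) f
  sumOver-∪ S T f = sum-mono λ i →
    ≤-trans (termwise (does (i ∈? S)) (does (i ∈? T)))
            (≤-reflexive (cong (if_then f i else 0) (sym (∈?-∪ S T i))))

sumOver-remove : (S : Subset p) (f : Fin p → ℕ) (i : Fin p) → does (i ∈? S) ≡ true →
  sumOver S f ≡ f i + sumOver (S [ i ]≔ outside) f
sumOver-remove (inside  ∷ S) f zero    i∈S = refl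
sumOver-remove (inside  ∷ S) f (suc i) i∈S =
  trans (cong (f zero +_) (sumOver-remove S (f ∘ suc) i i∈S)) (swap (f zero) (f (suc i)) _)
  where
  swap : ∀ x y z → x + (y + z) ≡ y + (x + z)
  swap = solve-∀
sumOver-remove (outside ∷ S) f (suc i) i∈S = sumOver-remove S (f ∘ suc) i i∈S

sumOver-insert : (S : Subset p) (f : Fin p → ℕ) (i : Fin p) → does (i ∈? S) ≡ false →
  sumOver (S [ i ]≔ inside) f ≡ f i + sumOver S f
sumOver-insert (outside ∷ S) f zero    i∉S = refl
sumOver-insert (inside  ∷ S) f (suc i) i∉S =
  trans (cong (f zero +_) (sumOver-insert S (f ∘ suc) i i∉S)) (swap (f zero) (f (suc i)) _)
  where
  swap : ∀ x y z → x + (y + z) ≡ y + (x + z)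
  swap = solve-∀
sumOver-insert (outside ∷ S) f (suc i) i∉S = sumOver-insert S (f ∘ suc) i i∉S

sumOver-+ : (S : Subset p) (f g : Fin p → ℕ) →
  sumOver S (λ i → f i + g i) ≡ sumOver S f + sumOver S g
sumOver-+ S f g =
  trans (sum-cong-≗ λ i → distrib (does (i ∈? S)) (f i) (g i))
        (∑-distrib-+ (λ i → if does (i ∈? S) then f i else 0) _)
  where
  distrib : ∀ b x y → (if b then x + y else 0) ≡ (if b then x else 0) + (if b then y else 0)
  distrib true  x y = refl
  distrib false x y = refl

-- The factor `t` allows a product of two deltas to be summed one coordinate at a time.
sumOver-δ* : (S : Subset p) (i : Fin p) (t : ℕ) → sumOver S (λ i′ → δ i i′ * t) ≡ 𝟙 S i * t
sumOver-δ* (inside  ∷ S) zero    t = trans (cong (1 * t +_) (sumOver-zero S λ _ → refl)) (+-identityʳ _)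
sumOver-δ* (outside ∷ S) zero    t = sumOver-zero S λ _ → refl
sumOver-δ* (inside  ∷ S) (suc i) t = sumOver-δ* S i t
sumOver-δ* (outside ∷ S) (suc i) t = sumOver-δ* S i t

sum-δ : (i : Fin p) → sum (δ i) ≡ 1
sum-δ {suc p} zero    = cong suc (sum-zero {p} λ _ → refl)
sum-δ         (suc i) = sum-δ i

sumOver-+δ : (S : Subset p) (f : Fin p → ℕ) (i : Fin p) →
  sumOver S (λ i′ → f i′ + δ i i′) ≡ sumOver S f + 𝟙 S i
sumOver-+δ S f i = trans (sumOver-+ S f (δ i)) (cong (sumOver S f +_) (begin
  sumOver S (δ i)                ≡⟨ sumOver-cong S (λ i′ → sym (*-identityʳ (δ i i′))) ⟩
  sumOver S (λ i′ → δ i i′ * 1)  ≡⟨ sumOver-δ* S i 1 ⟩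
  𝟙 S i * 1                      ≡⟨ *-identityʳ (𝟙 S i) ⟩
  𝟙 S i                          ∎))
  where open ≡-Reasoning

-- Transportation

Matrix : ℕ → ℕ → Set
Matrix p q = Fin p → Fin q → ℕ

-- The total capacity leaving the cut with source side J ∪ K.
crossing : Matrix p q → Subset p → Subset q → ℕ
crossing c J K = sumOver (∁ K) (λ ℓ → sumOver J (λ j → c j ℓ))

-- In the network with source edges `a`, middle edges `c` and sink edges `b`, the cut with source
-- side `J` and `K` has capacity `sumOver (∁ J) a + sumOver K b + crossing c J
-- K`. Asking that this be at least `sum a`, and cancelling the part outside `J`, gives the
-- inequality below.
CutCondition : (Fin p → ℕ) → (Fin q → ℕ) → Matrix p q → Set
CutCondition {p} {q} a b c = ∀ (J : Subset p) (K : Subset q) →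
  sumOver J a ≤ sumOver K b + crossing c J K

record IsTransport (a : Fin p → ℕ) (b : Fin q → ℕ) (c x : Matrix p q) : Set where
  field
    capacity : ∀ j ℓ → x j ℓ ≤ c j ℓ
    supply   : ∀ j → ∑[ ℓ < q ] x j ℓ ≡ a j
    demand   : ∀ ℓ → ∑[ j < p ] x j ℓ ≡ b ℓ

-- What `J` sends goes either into `K`, where the demand bounds it, or out of the cut, where the
-- capacity does.
transport⇒cut : {a : Fin p → ℕ} {b : Fin q → ℕ} {c x : Matrix p q} →
  IsTransport a b c x → CutCondition a b c
transport⇒cut {q = q} {a} {b} {c} {x} tr J K = begin
  sumOver J a                                  ≡⟨ sumOver-cong J (sym ∘ supply) ⟩
  sumOver J (λ j → ∑[ ℓ < q ] x j ℓ)           ≡⟨ sumOver-∑ J x ⟩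
  ∑[ ℓ < q ] sumOver J (λ j → x j ℓ)           ≡⟨ sumOver-∁ K _ ⟨
  sumOver K (λ ℓ → sumOver J (λ j → x j ℓ)) + crossing x J K
    ≤⟨ +-mono-≤
         (sumOver-mono K λ ℓ → ≤-trans (sumOver≤sum J _) (≤-reflexive (demand ℓ)))
         (sumOver-mono (∁ K) λ ℓ → sumOver-mono J λ j → capacity j ℓ) ⟩
  sumOver K b + crossing c J K                 ∎
  where
  open ≤-Reasoning
  open IsTransport tr

crossing-cong : {c d : Matrix p q} → (∀ j ℓ → c j ℓ ≡ d j ℓ) → ∀ J K → crossing c J K ≡ crossing d J K
crossing-cong c≗d J K = sumOver-cong (∁ K) λ ℓ → sumOver-cong J λ j → c≗d j ℓ

cut-cong : {a a′ : Fin p → ℕ} {b b′ : Fin q → ℕ} {c c′ : Matrix p q} →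
  (∀ j → a j ≡ a′ j) → (∀ ℓ → b ℓ ≡ b′ ℓ) → (∀ j ℓ → c j ℓ ≡ c′ j ℓ) →
  CutCondition a b c → CutCondition a′ b′ c′
cut-cong a≗ b≗ c≗ cut J K = subst₂ _≤_ (sumOver-cong J a≗)
  (cong₂ _+_ (sumOver-cong K b≗) (crossing-cong c≗ J K)) (cut J K)

-- The contributions are compared for one `ℓ` at a time. If `ℓ` is in neither `K` nor `K′`, the two
-- sides agree by `sumOver-∪∩`. If it is in exactly one, only the intersection term survives on the
-- left, and it is at most the one surviving term on the right. If it is in both, nothing survives.
crossing-submodular : (c : Matrix p q) (J J′ : Subset p) (K K′ : Subset q) →
  crossing c (J ∪ J′) (K ∪ K′) + crossing c (J ∩ J′) (K ∩ K′) ≤ crossing c J K + crossing c J′ K′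
crossing-submodular {q = q} c J J′ K K′ = begin
  crossing c (J ∪ J′) (K ∪ K′) + crossing c (J ∩ J′) (K ∩ K′)
    ≡⟨ ∑-distrib-+ (λ ℓ → if does (ℓ ∈? ∁ (K ∪ K′)) then out (J ∪ J′) ℓ else 0) _ ⟨
  ∑[ ℓ < q ] ((if does (ℓ ∈? ∁ (K ∪ K′)) then out (J ∪ J′) ℓ else 0) +
              (if does (ℓ ∈? ∁ (K ∩ K′)) then out (J ∩ J′) ℓ else 0))
    ≤⟨ sum-mono column ⟩
  ∑[ ℓ < q ] ((if does (ℓ ∈? ∁ K) then out J ℓ else 0) + (if does (ℓ ∈? ∁ K′) then out J′ ℓ else 0))
    ≡⟨ ∑-distrib-+ (λ ℓ → if does (ℓ ∈? ∁ K) then out J ℓ else 0) _ ⟩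
  crossing c J K + crossing c J′ K′ ∎
  where
  open ≤-Reasoning
  out : Subset _ → Fin q → ℕ
  out J ℓ = sumOver J (λ j → c j ℓ)
  column : ∀ ℓ →
    (if does (ℓ ∈? ∁ (K ∪ K′)) then out (J ∪ J′) ℓ else 0) +
    (if does (ℓ ∈? ∁ (K ∩ K′)) then out (J ∩ J′) ℓ else 0) ≤
    (if does (ℓ ∈? ∁ K) then out J ℓ else 0) + (if does (ℓ ∈? ∁ K′) then out J′ ℓ else 0)
  column ℓ
    rewrite ∈?-∁ (K ∪ K′) ℓ | ∈?-∁ (K ∩ K′) ℓ | ∈?-∁ K ℓ | ∈?-∁ K′ ℓ | ∈?-∪ K K′ ℓ | ∈?-∩ K K′ ℓ
    with does (ℓ ∈? K) | does (ℓ ∈? K′)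
  ... | true  | true  = z≤n
  ... | true  | false = sumOver-∩ʳ J J′ _
  ... | false | true  = ≤-trans (sumOver-∩ˡ J J′ _) (m≤m+n _ _)
  ... | false | false = ≤-reflexive (sumOver-∪∩ J J′ _)

-- Changing one edge by a unit

unit : Fin p → Fin q → Matrix p q
unit j ℓ j′ ℓ′ = δ j j′ * δ ℓ ℓ′

crossing-+unit : (c : Matrix p q) (j : Fin p) (ℓ : Fin q) (J : Subset p) (K : Subset q) →
  crossing (λ j′ ℓ′ → c j′ ℓ′ + unit j ℓ j′ ℓ′) J K ≡ crossing c J K + 𝟙 J j * 𝟙 (∁ K) ℓ
crossing-+unit c j ℓ J K = begin
  crossing (λ j′ ℓ′ → c j′ ℓ′ + unit j ℓ j′ ℓ′) J K
    ≡⟨ sumOver-cong (∁ K) (λ ℓ′ → trans (sumOver-+ J (λ j′ → c j′ ℓ′) _)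
         (cong (sumOver J (λ j′ → c j′ ℓ′) +_)
           (trans (sumOver-δ* J j (δ ℓ ℓ′)) (*-comm (𝟙 J j) (δ ℓ ℓ′))))) ⟩
  sumOver (∁ K) (λ ℓ′ → sumOver J (λ j′ → c j′ ℓ′) + δ ℓ ℓ′ * 𝟙 J j)
    ≡⟨ sumOver-+ (∁ K) (λ ℓ′ → sumOver J (λ j′ → c j′ ℓ′)) _ ⟩
  crossing c J K + sumOver (∁ K) (λ ℓ′ → δ ℓ ℓ′ * 𝟙 J j)
    ≡⟨ cong (crossing c J K +_) (trans (sumOver-δ* (∁ K) ℓ (𝟙 J j)) (*-comm (𝟙 (∁ K) ℓ) (𝟙 J j))) ⟩
  crossing c J K + 𝟙 J j * 𝟙 (∁ K) ℓ ∎
  where open ≡-Reasoning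

total : Matrix p q → ℕ
total {p} {q} c = ∑[ j < p ] ∑[ ℓ < q ] c j ℓ

entry≤total : (c : Matrix p q) (j : Fin p) (ℓ : Fin q) → c j ℓ ≤ total c
entry≤total c j ℓ = ≤-trans (term≤sum (c j) ℓ) (term≤sum (λ j → sum (c j)) j)

sum-+δ : (f : Fin p → ℕ) (i : Fin p) → ∑[ i′ < p ] (f i′ + δ i i′) ≡ sum f + 1
sum-+δ f i = trans (∑-distrib-+ f (δ i)) (cong (sum f +_) (sum-δ i))

row-+unit : (c : Matrix p q) (j : Fin p) (ℓ : Fin q) (j′ : Fin p) →
  ∑[ ℓ′ < q ] (c j′ ℓ′ + unit j ℓ j′ ℓ′) ≡ ∑[ ℓ′ < q ] c j′ ℓ′ + δ j j′
row-+unit c j ℓ j′ = trans (∑-distrib-+ (c j′) (unit j ℓ j′)) (cong (sum (c j′) +_) (begin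
  sum (unit j ℓ j′)    ≡⟨ *-distribˡ-sum (δ j j′) (δ ℓ) ⟨
  δ j j′ * sum (δ ℓ)   ≡⟨ cong (δ j j′ *_) (sum-δ ℓ) ⟩
  δ j j′ * 1           ≡⟨ *-identityʳ (δ j j′) ⟩
  δ j j′               ∎))
  where open ≡-Reasoning

column-+unit : (c : Matrix p q) (j : Fin p) (ℓ : Fin q) (ℓ′ : Fin q) →
  ∑[ j′ < p ] (c j′ ℓ′ + unit j ℓ j′ ℓ′) ≡ ∑[ j′ < p ] c j′ ℓ′ + δ ℓ ℓ′
column-+unit c j ℓ ℓ′ =
  trans (sum-cong-≗ λ j′ → cong (c j′ ℓ′ +_) (*-comm (δ j j′) (δ ℓ ℓ′)))
        (row-+unit (λ ℓ j → c j ℓ) ℓ j ℓ′)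

total-+unit : (c : Matrix p q) (j : Fin p) (ℓ : Fin q) →
  total (λ j′ ℓ′ → c j′ ℓ′ + unit j ℓ j′ ℓ′) ≡ total c + 1
total-+unit c j ℓ =
  trans (sum-cong-≗ (row-+unit c j ℓ)) (sum-+δ (λ j′ → sum (c j′)) j)

δ≤ : {f : Fin p → ℕ} {i : Fin p} → 1 ≤ f i → ∀ i′ → δ i i′ ≤ f i′
δ≤ {i = i} 1≤fi i′ with i ≟ i′
... | yes refl = 1≤fi
... | no  _    = z≤n

unit≤ : {c : Matrix p q} {j : Fin p} {ℓ : Fin q} → 1 ≤ c j ℓ → ∀ j′ ℓ′ → unit j ℓ j′ ℓ′ ≤ c j′ ℓ′
unit≤ {c = c} {j} {ℓ} 1≤c j′ ℓ′ with j ≟ j′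
... | yes refl = ≤-trans (≤-reflexive (*-identityˡ (δ ℓ ℓ′))) (δ≤ {f = c j} 1≤c ℓ′)
... | no  _    = z≤n

-- Here `c` is the capacity after one unit has been taken from the edge from `j` to `ℓ`, and `c⁺`
-- the capacity before. The pair `J`, `K` is a cut that fails for `c`, although every cut holds for
-- `c⁺`.
module Violated {p q : ℕ} (c : Matrix p q) (j : Fin p) (ℓ : Fin q) (J : Subset p) (K : Subset q) where

  c⁺ : Matrix p q
  c⁺ j′ ℓ′ = c j′ ℓ′ + unit j ℓ j′ ℓ′

  module _ {a : Fin p → ℕ} {b : Fin q → ℕ} (cut : CutCondition a b c⁺)
           (violated : sumOver K b + crossing c J K < sumOver J a) where

    -- A cut that the edge does not leave has the same capacity under `c` and `c⁺`. Hence the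
    -- violated cut has `j` inside `J` and `ℓ` outside `K`.
    uncrossed : ∀ J′ K′ → 𝟙 J′ j * 𝟙 (∁ K′) ℓ ≡ 0 →
      sumOver J′ a ≤ sumOver K′ b + crossing c J′ K′
    uncrossed J′ K′ 𝟙≡0 = begin
      sumOver J′ a                                                    ≤⟨ cut J′ K′ ⟩
      sumOver K′ b + crossing c⁺ J′ K′
        ≡⟨ cong (sumOver K′ b +_) (crossing-+unit c j ℓ J′ K′) ⟩
      sumOver K′ b + (crossing c J′ K′ + 𝟙 J′ j * 𝟙 (∁ K′) ℓ)
        ≡⟨ cong (λ t → sumOver K′ b + (crossing c J′ K′ + t)) 𝟙≡0 ⟩
      sumOver K′ b + (crossing c J′ K′ + 0)
        ≡⟨ cong (sumOver K′ b +_) (+-identityʳ _) ⟩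
      sumOver K′ b + crossing c J′ K′                                 ∎
      where open ≤-Reasoning

    crossed : 𝟙 J j * 𝟙 (∁ K) ℓ ≢ 0
    crossed 𝟙≡0 = <⇒≱ violated (uncrossed J K 𝟙≡0)

    j∈J : does (j ∈? J) ≡ true
    j∈J with does (j ∈? J) | crossed
    ... | true  | _  = refl
    ... | false | ≢0 = contradiction refl ≢0

    ℓ∈∁K : does (ℓ ∈? ∁ K) ≡ true
    ℓ∈∁K with does (ℓ ∈? ∁ K) | crossed
    ... | true  | _  = refl
    ... | false | ≢0 = contradiction (*-zeroʳ (𝟙 J j)) ≢0

    ℓ∉K : does (ℓ ∈? K) ≡ false
    ℓ∉K with does (ℓ ∈? K) | trans (sym (∈?-∁ K ℓ)) ℓ∈∁K
    ... | false | _ = refl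

    -- If `a j` were zero, dropping `j` from `J` would keep the supply and not increase the crossing
    -- capacity. The edge does not leave the new cut, so that cut holds, and then so would the
    -- violated one.
    supply-positive : 1 ≤ a j
    supply-positive = n≢0⇒n>0 λ aj≡0 → <⇒≱ violated (begin
      sumOver J a                      ≡⟨ sumOver-remove J a j j∈J ⟩
      a j + sumOver J⁻ a               ≡⟨ cong (_+ sumOver J⁻ a) aj≡0 ⟩
      sumOver J⁻ a
        ≤⟨ uncrossed J⁻ K (cong (λ b → (if b then 1 else 0) * 𝟙 (∁ K) ℓ) (∈?-≔ J j outside)) ⟩
      sumOver K b + crossing c J⁻ K
        ≤⟨ +-monoʳ-≤ (sumOver K b) (sumOver-mono (∁ K) λ ℓ′ →
             ≤-trans (m≤n+m _ (c j ℓ′)) (≤-reflexive (sym (sumOver-remove J (λ j → c j ℓ′) j j∈J)))) ⟩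
      sumOver K b + crossing c J K     ∎)
      where
      open ≤-Reasoning
      J⁻ = J [ j ]≔ outside

    -- Dual to `supply-positive`: if `b ℓ` were zero, `ℓ` could be added to `K` at no cost, giving a
    -- cut that the edge does not leave.
    demand-positive : 1 ≤ b ℓ
    demand-positive = n≢0⇒n>0 λ bℓ≡0 → <⇒≱ violated (begin
      sumOver J a
        ≤⟨ uncrossed J K⁺ (trans
             (cong (λ S → 𝟙 J j * 𝟙 S ℓ) ∁K⁺)
             (trans (cong (λ b → 𝟙 J j * (if b then 1 else 0)) (∈?-≔ (∁ K) ℓ outside))
                    (*-zeroʳ (𝟙 J j)))) ⟩
      sumOver K⁺ b + crossing c J K⁺
        ≡⟨ cong (_+ crossing c J K⁺) (trans (sumOver-insert K b ℓ ℓ∉K) (cong (_+ sumOver K b) bℓ≡0)) ⟩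
      sumOver K b + crossing c J K⁺
        ≡⟨ cong (λ S → sumOver K b + sumOver S (out J)) ∁K⁺ ⟩
      sumOver K b + sumOver (∁ K [ ℓ ]≔ outside) (out J)
        ≤⟨ +-monoʳ-≤ (sumOver K b) (m≤n+m _ (out J ℓ)) ⟩
      sumOver K b + (out J ℓ + sumOver (∁ K [ ℓ ]≔ outside) (out J))
        ≡⟨ cong (sumOver K b +_) (sumOver-remove (∁ K) (out J) ℓ ℓ∈∁K) ⟨
      sumOver K b + crossing c J K     ∎)
      where
      open ≤-Reasoning
      out : Subset p → Fin q → ℕ
      out J ℓ = sumOver J (λ j → c j ℓ)
      K⁺ = K [ ℓ ]≔ inside
      ∁K⁺ : ∁ K⁺ ≡ ∁ K [ ℓ ]≔ outside
      ∁K⁺ = map-[]≔ not K ℓ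

  -- The only cuts (J′, K′) that could suffer from shipping the unit j → ℓ have
  -- j ∉ J′ and ℓ ∈ K′; uncrossing such a cut with the violated one bounds it.
  ship : {a : Fin p → ℕ} {b : Fin q → ℕ} →
    CutCondition (λ j′ → a j′ + δ j j′) (λ ℓ′ → b ℓ′ + δ ℓ ℓ′) c⁺ →
    sumOver K (λ ℓ′ → b ℓ′ + δ ℓ ℓ′) + crossing c J K < sumOver J (λ j′ → a j′ + δ j j′) →
    CutCondition a b c
  ship {a} {b} cut violated J′ K′ = go (does (j ∈? J′)) (does (ℓ ∈? K′)) refl refl
    where
    open ≤-Reasoning
    A : Subset p → ℕ
    A S = sumOver S a
    B : Subset q → ℕ
    B T = sumOver T b
    C : Subset p → Subset q → ℕ
    C = crossing c

    ι : Bool → ℕ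
    ι b = if b then 1 else 0

    -- The bits `u` and `v` record whether `j` is in `S` and `ℓ` is in `T`. The extra units on the
    -- two sides balance unless `u` is false and `v` is true, when the right side has one more.
    cutAt : ∀ S T {u v} → does (j ∈? S) ≡ u → does (ℓ ∈? T) ≡ v →
      A S + ι u ≤ (B T + ι v) + (C S T + ι u * ι (not v))
    cutAt S T refl refl = subst₂ _≤_ (sumOver-+δ S a j)
      (cong₂ _+_ (sumOver-+δ T b ℓ)
        (trans (crossing-+unit c j ℓ S T) (cong (λ t → C S T + 𝟙 S j * ι t) (∈?-∁ T ℓ))))
      (cut S T)

    go : ∀ u v → does (j ∈? J′) ≡ u → does (ℓ ∈? K′) ≡ v → A J′ ≤ B K′ + C J′ K′
    go true true u v = +-cancelʳ-≤ 1 _ _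
      (≤-trans (cutAt J′ K′ u v) (≤-reflexive (rearrange (B K′) (C J′ K′))))
      where
      rearrange : ∀ x y → x + 1 + (y + 0) ≡ x + y + 1
      rearrange = solve-∀
    go true false u v = +-cancelʳ-≤ 1 _ _
      (≤-trans (cutAt J′ K′ u v) (≤-reflexive (rearrange (B K′) (C J′ K′))))
      where
      rearrange : ∀ x y → x + 0 + (y + 1) ≡ x + y + 1
      rearrange = solve-∀
    go false false u v = +-cancelʳ-≤ 0 _ _
      (≤-trans (cutAt J′ K′ u v) (≤-reflexive (rearrange (B K′) (C J′ K′))))
      where
      rearrange : ∀ x y → x + 0 + (y + 0) ≡ x + y + 0
      rearrange = solve-∀
    -- The strict violation at `J`, `K` is added, and the cut condition is used at the union and at
    -- the intersection. Strictness supplies the 1 that pays for `ℓ` lying in `K ∪ K′`; the bits `s`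
    -- and `t` stay symbolic and cancel.
    go false true u v = +-cancelˡ-≤ (B K + t + C J K + 1) _ _ (begin
      (B K + t + C J K + 1) + A J′
        ≡⟨ cong (_+ A J′) (+-comm _ 1) ⟩
      suc (B K + t + C J K) + A J′
        ≤⟨ +-monoˡ-≤ (A J′) (subst₂ _≤_
             (cong (λ x → suc (x + C J K)) (sumOver-+δ K b ℓ)) (sumOver-+δ J a j) violated) ⟩
      (A J + s) + A J′
        ≡⟨ trans (swap (A J) s (A J′)) (cong (_+ s) (sym (sumOver-∪∩ J J′ a))) ⟩
      (A (J ∪ J′) + A (J ∩ J′)) + s
        ≡⟨ regroup (A (J ∪ J′)) (A (J ∩ J′)) s ⟩
      (A (J ∪ J′) + s) + (A (J ∩ J′) + 0)
        ≤⟨ +-mono-≤ (cutAt (J ∪ J′) (K ∪ K′) j∈∪ ℓ∈∪) (cutAt (J ∩ J′) (K ∩ K′) j∈∩ ℓ∈∩) ⟩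
      ((B (K ∪ K′) + 1) + (C (J ∪ J′) (K ∪ K′) + s * 0)) +
        ((B (K ∩ K′) + t) + (C (J ∩ J′) (K ∩ K′) + 0))
        ≡⟨ collect (B (K ∪ K′)) (C (J ∪ J′) (K ∪ K′)) (B (K ∩ K′)) (C (J ∩ J′) (K ∩ K′)) s t ⟩
      (B (K ∪ K′) + B (K ∩ K′)) + (C (J ∪ J′) (K ∪ K′) + C (J ∩ J′) (K ∩ K′)) + (1 + t)
        ≤⟨ +-monoˡ-≤ (1 + t) (+-mono-≤ (≤-reflexive (sumOver-∪∩ K K′ b)) (crossing-submodular c J J′ K K′)) ⟩
      (B K + B K′) + (C J K + C J′ K′) + (1 + t)
        ≡⟨ separate (B K) (B K′) (C J K) (C J′ K′) t ⟩
      (B K + t + C J K + 1) + (B K′ + C J′ K′) ∎)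
      where
      s t : ℕ
      s = 𝟙 J j
      t = 𝟙 K ℓ
      j∈∪ : does (j ∈? (J ∪ J′)) ≡ does (j ∈? J)
      j∈∪ = trans (∈?-∪ J J′ j) (trans (cong (does (j ∈? J) ∨_) u) (∨-identityʳ _))
      j∈∩ : does (j ∈? (J ∩ J′)) ≡ false
      j∈∩ = trans (∈?-∩ J J′ j) (trans (cong (does (j ∈? J) ∧_) u) (∧-zeroʳ _))
      ℓ∈∪ : does (ℓ ∈? (K ∪ K′)) ≡ true
      ℓ∈∪ = trans (∈?-∪ K K′ ℓ) (trans (cong (does (ℓ ∈? K) ∨_) v) (∨-zeroʳ _))
      ℓ∈∩ : does (ℓ ∈? (K ∩ K′)) ≡ does (ℓ ∈? K)
      ℓ∈∩ = trans (∈?-∩ K K′ ℓ) (trans (cong (does (ℓ ∈? K) ∧_) v) (∧-identityʳ _))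
      swap : ∀ x y z → (x + y) + z ≡ (x + z) + y
      swap = solve-∀
      regroup : ∀ x y z → (x + y) + z ≡ (x + z) + (y + 0)
      regroup = solve-∀
      collect : ∀ b c b′ c′ s t →
        ((b + 1) + (c + s * 0)) + ((b′ + t) + (c′ + 0)) ≡ (b + b′) + (c + c′) + (1 + t)
      collect = solve-∀
      separate : ∀ b b′ c c′ t → (b + b′) + (c + c′) + (1 + t) ≡ (b + t + c + 1) + (b′ + c′)
      separate = solve-∀

-- Integral max-flow min-cut for a bipartite network, by induction on the total capacity. Equality
-- of the totals ensures that all demands are met when all supplies are.
cut⇒transport : (a : Fin p → ℕ) (b : Fin q → ℕ) (c : Matrix p q) →
  sum a ≡ sum b → CutCondition a b c → ∃[ x ] IsTransport a b c x
cut⇒transport a b c = byCapacity (total c) a b c refl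
  where
  -- Spend one unit of the capacity of an arbitrary edge: discard it if the cut
  -- condition survives, and otherwise ship along it.
  byCapacity : ∀ N (a : Fin p → ℕ) (b : Fin q → ℕ) (c : Matrix p q) → total c ≡ N →
    sum a ≡ sum b → CutCondition a b c → ∃[ x ] IsTransport a b c x
  byCapacity {p} {q} N a b c c≡N a≡b cut with any? (λ j → any? (λ ℓ → 1 ≤? c j ℓ))
  ... | no none = (λ _ _ → 0) , record
    { capacity = λ _ _ → z≤n
    ; supply   = λ j → trans (sum-zero {q} λ _ → refl) (sym (vanish a suma≡0 j))
    ; demand   = λ ℓ → trans (sum-zero {p} λ _ → refl) (sym (vanish b (trans (sym a≡b) suma≡0) ℓ))
    }
    where
    open ≤-Reasoning
    c≗0 : ∀ j ℓ → c j ℓ ≡ 0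
    c≗0 j ℓ = n<1⇒n≡0 (≰⇒> λ 1≤c → none (j , ℓ , 1≤c))
    -- With zero capacity, the cut containing every supply vertex and no demand vertex has nothing
    -- on its right side.
    suma≡0 : sum a ≡ 0
    suma≡0 = n≤0⇒n≡0 (begin
      sum a                       ≡⟨ sumOver-⊤ a ⟨
      sumOver ⊤ a                 ≤⟨ cut ⊤ ⊥ ⟩
      sumOver ⊥ b + crossing c ⊤ ⊥
        ≡⟨ cong₂ _+_ (sumOver-⊥ b) (sumOver-zero (∁ ⊥) λ ℓ → sumOver-zero ⊤ λ j → c≗0 j ℓ) ⟩
      0                           ∎)
    vanish : ∀ {m} (f : Fin m → ℕ) → sum f ≡ 0 → ∀ i → f i ≡ 0
    vanish f f≡0 i = n≤0⇒n≡0 (≤-trans (term≤sum f i) (≤-reflexive f≡0))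
  byCapacity zero a b c c≡N a≡b cut | yes (j , ℓ , 1≤c) =
    contradiction (≤-trans 1≤c (≤-trans (entry≤total c j ℓ) (≤-reflexive c≡N))) λ ()
  byCapacity (suc N) a b c c≡N a≡b cut | yes (j , ℓ , 1≤c) =
    -- There are finitely many pairs of subsets, so the search either finds a cut violated by `c⁻`
    -- or proves the cut condition for `c⁻`.
    step (anySubset? λ J → anySubset? λ K → sumOver K b + crossing c⁻ J K <? sumOver J a)
    where
    c⁻ : Matrix _ _
    c⁻ j′ ℓ′ = c j′ ℓ′ ∸ unit j ℓ j′ ℓ′
    c-split : ∀ j′ ℓ′ → c⁻ j′ ℓ′ + unit j ℓ j′ ℓ′ ≡ c j′ ℓ′
    c-split j′ ℓ′ = m∸n+n≡m (unit≤ {c = c} 1≤c j′ ℓ′)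
    c⁻≡N : total c⁻ ≡ N
    c⁻≡N = +-cancelʳ-≡ 1 _ _ (trans (sym (total-+unit c⁻ j ℓ)) (trans
      (sum-cong-≗ λ j′ → sum-cong-≗ (c-split j′)) (trans c≡N (+-comm 1 N))))
    step : Dec (∃[ J ] ∃[ K ] sumOver K b + crossing c⁻ J K < sumOver J a) →
           ∃[ x ] IsTransport a b c x
    step (no valid) =
      let x , tr = byCapacity N a b c⁻ c⁻≡N a≡b (λ J K → ≮⇒≥ λ bad → valid (J , K , bad))
          open IsTransport tr
      in x , record
        { capacity = λ j′ ℓ′ → ≤-trans (capacity j′ ℓ′) (m∸n≤m _ (unit j ℓ j′ ℓ′))
        ; supply   = supply
        ; demand   = demand
        }
    -- The violated cut guarantees a unit of supply at `j` and of demand at `ℓ`, so `a⁻` and `b⁻`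
    -- subtract without truncation. The shipped unit is added to the solution of the smaller
    -- problem.
    step (yes (J , K , violated)) =
      let x , tr = byCapacity N a⁻ b⁻ c⁻ c⁻≡N a⁻≡b⁻ (ship
                     (cut-cong (sym ∘ a-split) (sym ∘ b-split) (λ _ _ → refl) cut⁺)
                     (subst₂ _<_ (cong (_+ crossing c⁻ J K) (sumOver-cong K (sym ∘ b-split)))
                                 (sumOver-cong J (sym ∘ a-split)) violated))
          open IsTransport tr
      in (λ j′ ℓ′ → x j′ ℓ′ + unit j ℓ j′ ℓ′) , record
        { capacity = λ j′ ℓ′ → ≤-trans (+-monoˡ-≤ (unit j ℓ j′ ℓ′) (capacity j′ ℓ′))
                                       (≤-reflexive (c-split j′ ℓ′))
        ; supply   = λ j′ → trans (row-+unit x j ℓ j′)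
                                  (trans (cong (_+ δ j j′) (supply j′)) (a-split j′))
        ; demand   = λ ℓ′ → trans (column-+unit x j ℓ ℓ′)
                                  (trans (cong (_+ δ ℓ ℓ′) (demand ℓ′)) (b-split ℓ′))
        }
      where
      open Violated c⁻ j ℓ J K
      cut⁺ : CutCondition a b c⁺
      cut⁺ = cut-cong (λ _ → refl) (λ _ → refl) (λ j′ ℓ′ → sym (c-split j′ ℓ′)) cut
      a⁻ : Fin _ → ℕ
      a⁻ j′ = a j′ ∸ δ j j′
      b⁻ : Fin _ → ℕ
      b⁻ ℓ′ = b ℓ′ ∸ δ ℓ ℓ′
      a-split : ∀ j′ → a⁻ j′ + δ j j′ ≡ a j′
      a-split j′ = m∸n+n≡m (δ≤ {f = a} {j} (supply-positive cut⁺ violated) j′)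
      b-split : ∀ ℓ′ → b⁻ ℓ′ + δ ℓ ℓ′ ≡ b ℓ′
      b-split ℓ′ = m∸n+n≡m (δ≤ {f = b} {ℓ} (demand-positive cut⁺ violated) ℓ′)
      a⁻≡b⁻ : sum a⁻ ≡ sum b⁻
      a⁻≡b⁻ = +-cancelʳ-≡ 1 _ _ (trans (sym (sum-+δ a⁻ j)) (trans (sum-cong-≗ a-split)
        (trans a≡b (trans (sym (sum-cong-≗ b-split)) (sum-+δ b⁻ ℓ)))))

-- Decomposition into matchings

-- The matrix `x` transports the scaled margins within capacity `x`, so it satisfies the scaled cut
-- condition. Cancelling the factor leaves the cut condition for `a`, `b` with capacity `x`, and
-- this yields an integral solution.
roundDown : (a : Fin p → ℕ) (b : Fin q → ℕ) (x : Matrix p q) (m : ℕ) → sum a ≡ sum b →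
  (∀ j → ∑[ ℓ < q ] x j ℓ ≡ suc m * a j) → (∀ ℓ → ∑[ j < p ] x j ℓ ≡ suc m * b ℓ) →
  ∃[ y ] IsTransport a b x y
roundDown a b x m a≡b rows columns = cut⇒transport a b x a≡b λ J K →
  *-cancelˡ-≤ (suc m) (begin
    suc m * sumOver J a                                   ≡⟨ sumOver-*ˡ J (suc m) a ⟨
    sumOver J (λ j → suc m * a j)                         ≤⟨ transport⇒cut scaled J K ⟩
    sumOver K (λ ℓ → suc m * b ℓ) + crossing x J K
      ≡⟨ cong (_+ crossing x J K) (sumOver-*ˡ K (suc m) b) ⟩
    suc m * sumOver K b + crossing x J K
      -- Extra copies of the crossing capacity are added so that `suc m` becomes a common factor.
      ≤⟨ +-monoʳ-≤ (suc m * sumOver K b) (m≤m+n _ (m * crossing x J K)) ⟩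
    suc m * sumOver K b + suc m * crossing x J K
      ≡⟨ *-distribˡ-+ (suc m) (sumOver K b) (crossing x J K) ⟨
    suc m * (sumOver K b + crossing x J K)                ∎)
  where
  open ≤-Reasoning
  scaled : IsTransport (λ j → suc m * a j) (λ ℓ → suc m * b ℓ) x x
  scaled = record { capacity = λ _ _ → ≤-refl ; supply = rows ; demand = columns }

sum-∸ : (f g : Fin p → ℕ) → (∀ i → g i ≤ f i) → ∑[ i < p ] (f i ∸ g i) + sum g ≡ sum f
sum-∸ f g g≤f = trans (sym (∑-distrib-+ (λ i → f i ∸ g i) g)) (sum-cong-≗ λ i → m∸n+n≡m (g≤f i))

-- A rounded matrix `y` lies below `x`, so it can be subtracted, and the remainder has margins
-- `m * a` and `m * b`: the induction continues. With unit margins this is the decomposition of a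
-- regular bipartite multigraph into perfect matchings.
decompose : (m : ℕ) (a : Fin p → ℕ) (b : Fin q → ℕ) (x : Matrix p q) → sum a ≡ sum b →
  (∀ j → ∑[ ℓ < q ] x j ℓ ≡ m * a j) → (∀ ℓ → ∑[ j < p ] x j ℓ ≡ m * b ℓ) →
  Σ[ Y ∈ (Fin m → Matrix p q) ]
    (∀ i → IsTransport a b x (Y i)) × (∀ j ℓ → ∑[ i < m ] Y i j ℓ ≡ x j ℓ)
decompose zero a b x a≡b rows columns = (λ ()) , (λ ()) , λ j ℓ →
  sym (n≤0⇒n≡0 (≤-trans (term≤sum (x j) ℓ) (≤-reflexive (rows j))))
decompose (suc m) a b x a≡b rows columns =
  let y , tr = roundDown a b x m a≡b rows columns
      open IsTransport tr
      rest j = λ ℓ → x j ℓ ∸ y j ℓ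
      peel : ∀ {s t u v} → s + t ≡ u → t ≡ v → u ≡ v + m * v → s ≡ m * v
      peel {s} {v = v} s+t≡u t≡v u≡ = +-cancelʳ-≡ v s _
        (trans (cong (s +_) (sym t≡v)) (trans s+t≡u (trans u≡ (+-comm v _))))
      Y , trs , ∑Y = decompose m a b rest a≡b
        (λ j → peel (sum-∸ (x j) (y j) (capacity j)) (supply j) (rows j))
        (λ ℓ → peel (sum-∸ (λ j → x j ℓ) (λ j → y j ℓ) (λ j → capacity j ℓ)) (demand ℓ) (columns ℓ))
  in (λ { zero → y ; (suc i) → Y i })
   , (λ { zero → tr
        ; (suc i) → let open IsTransport (trs i) renaming (capacity to cap; supply to sup; demand to dem)
                    in record { capacity = λ j ℓ → ≤-trans (cap j ℓ) (m∸n≤m _ (y j ℓ))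
                              ; supply = sup ; demand = dem } })
   , λ j ℓ → trans (cong (y j ℓ +_) (∑Y j ℓ)) (m+[n∸m]≡n (capacity j ℓ))

-- Zero-one rows as values, and injectivity by counting

δ-refl : (i : Fin p) → δ i i ≡ 1
δ-refl zero    = refl
δ-refl (suc i) = δ-refl i

-- This reads the row of a column vertex in a matching as the one symbol chosen there.
sum≡1⇒δ : (f : Fin p → ℕ) → sum f ≡ 1 → ∃[ i ] ∀ i′ → f i′ ≡ δ i i′
sum≡1⇒δ {suc p} f f≡1 with f zero in f0 | f≡1
... | 0           | rest≡1 = let i , f≗δ = sum≡1⇒δ (f ∘ suc) rest≡1
                             in suc i , λ { zero → f0 ; (suc i′) → f≗δ i′ }
... | 1           | rest≡1 = zero , λ
  { zero     → f0
  ; (suc i′) → n≤0⇒n≡0 (≤-trans (term≤sum (f ∘ suc) i′) (≤-reflexive (+-cancelˡ-≡ 1 _ 0 rest≡1))) }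
... | suc (suc _) | ()

sum≤1⇒unique : (f : Fin p → ℕ) → sum f ≤ 1 → ∀ i i′ → 1 ≤ f i → 1 ≤ f i′ → i ≡ i′
sum≤1⇒unique f f≤1 zero    zero     _ _ = refl
sum≤1⇒unique f f≤1 zero    (suc i′) u v =
  contradiction (≤-trans (+-mono-≤ u (≤-trans v (term≤sum (f ∘ suc) i′))) f≤1) (<-irrefl refl)
sum≤1⇒unique f f≤1 (suc i) zero     u v =
  contradiction (≤-trans (+-mono-≤ v (≤-trans u (term≤sum (f ∘ suc) i))) f≤1) (<-irrefl refl)
sum≤1⇒unique f f≤1 (suc i) (suc i′) u v =
  cong suc (sum≤1⇒unique (f ∘ suc) (≤-trans (m≤n+m _ (f zero)) f≤1) i i′ u v)

-- Injectivity in counting form lets the latin property be derived from, and turned into, bounds on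
-- sums.
fibres≤1⇒injective : (g : Fin p → Fin q) → (∀ ℓ → ∑[ i < p ] δ (g i) ℓ ≤ 1) → Injective _≡_ _≡_ g
fibres≤1⇒injective g fibres {i} {i′} gi≡gi′ = sum≤1⇒unique (λ i → δ (g i) (g i′)) (fibres (g i′)) i i′
  (≤-reflexive (sym (trans (cong (λ ℓ → δ ℓ (g i′)) gi≡gi′) (δ-refl (g i′)))))
  (≤-reflexive (sym (δ-refl (g i′))))

injective⇒fibres≤1 : (g : Fin p → Fin q) → Injective _≡_ _≡_ g → ∀ ℓ → ∑[ i < p ] δ (g i) ℓ ≤ 1
injective⇒fibres≤1 {zero}  g inj ℓ = z≤n
injective⇒fibres≤1 {suc p} g inj ℓ with g zero ≟ ℓ
... | no  _    = injective⇒fibres≤1 (g ∘ suc) (suc-injective ∘ inj) ℓ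
... | yes refl = ≤-reflexive (cong suc (sum-zero λ i → off i))
  where
  off : ∀ i → δ (g (suc i)) (g zero) ≡ 0
  off i with g (suc i) ≟ g zero
  ... | no  _  = refl
  ... | yes eq with () ← inj eq

-- A dummy vertex, numbered 0, absorbs the slack m ∸ d ℓ of every ℓ, so that each
-- of the m rounds is a perfect matching of the k symbols, k ∸ n of them with it.
matchings : n ≤ k → (m : ℕ) (d : Fin k → ℕ) (h : Matrix n k) → (∀ ℓ → d ℓ ≤ m) →
  (∀ j → ∑[ ℓ < k ] h j ℓ ≡ m) → (∀ ℓ → ∑[ j < n ] h j ℓ ≡ d ℓ) →
  Σ[ f ∈ (Fin m → Fin n → Fin k) ]
    (∀ i → Injective _≡_ _≡_ (f i)) × (∀ j ℓ → ∑[ i < m ] δ (f i j) ℓ ≡ h j ℓ)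
matchings {n} {k} n≤k m d h d≤m rows columns = f , f-injective , f-fibres
  where
  open ≡-Reasoning
  a : Fin (suc n) → ℕ
  a zero    = k ∸ n
  a (suc j) = 1
  b : Fin k → ℕ
  b ℓ = 1
  x : Matrix (suc n) k
  x zero    ℓ = m ∸ d ℓ
  x (suc j) ℓ = h j ℓ

  a≡b : sum a ≡ sum b
  a≡b = begin
    k ∸ n + ∑[ j < n ] 1  ≡⟨ cong (k ∸ n +_) (trans (sum-const n 1) (*-identityʳ n)) ⟩
    k ∸ n + n             ≡⟨ m∸n+n≡m n≤k ⟩
    k                     ≡⟨ trans (sum-const k 1) (*-identityʳ k) ⟨
    sum b                 ∎

  sum-d : sum d ≡ n * m
  sum-d = begin
    sum d                        ≡⟨ sum-cong-≗ columns ⟨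
    ∑[ ℓ < k ] ∑[ j < n ] h j ℓ  ≡⟨ ∑-comm (λ ℓ j → h j ℓ) ⟩
    ∑[ j < n ] ∑[ ℓ < k ] h j ℓ  ≡⟨ sum-cong-≗ rows ⟩
    ∑[ j < n ] m                 ≡⟨ sum-const n m ⟩
    n * m                        ∎

  x-rows : ∀ j → ∑[ ℓ < k ] x j ℓ ≡ m * a j
  -- The total slack is `k * m` less the sum `n * m` of all `d ℓ`. Adding `n * m` to both sides
  -- avoids truncated subtraction.
  x-rows zero = +-cancelʳ-≡ (n * m) _ _ (begin
    ∑[ ℓ < k ] (m ∸ d ℓ) + n * m  ≡⟨ cong (∑[ ℓ < k ] (m ∸ d ℓ) +_) sum-d ⟨
    ∑[ ℓ < k ] (m ∸ d ℓ) + sum d  ≡⟨ sum-∸ (λ _ → m) d d≤m ⟩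
    ∑[ ℓ < k ] m                  ≡⟨ sum-const k m ⟩
    k * m                         ≡⟨ cong (_* m) (m∸n+n≡m n≤k) ⟨
    (k ∸ n + n) * m               ≡⟨ *-distribʳ-+ m (k ∸ n) n ⟩
    (k ∸ n) * m + n * m           ≡⟨ cong (_+ n * m) (*-comm (k ∸ n) m) ⟩
    m * (k ∸ n) + n * m           ∎)
  x-rows (suc j) = trans (rows j) (sym (*-identityʳ m))

  x-columns : ∀ ℓ → ∑[ j < suc n ] x j ℓ ≡ m * 1
  x-columns ℓ = begin
    m ∸ d ℓ + ∑[ j < n ] h j ℓ  ≡⟨ cong (m ∸ d ℓ +_) (columns ℓ) ⟩
    m ∸ d ℓ + d ℓ               ≡⟨ m∸n+n≡m (d≤m ℓ) ⟩
    m                           ≡⟨ *-identityʳ m ⟨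
    m * 1                       ∎

  rounds = decompose m a b x a≡b x-rows x-columns
  Y = proj₁ rounds
  module Round i = IsTransport (proj₁ (proj₂ rounds) i)

  choice : ∀ i j → ∃[ ℓ ] ∀ ℓ′ → Y i (suc j) ℓ′ ≡ δ ℓ ℓ′
  choice i j = sum≡1⇒δ (Y i (suc j)) (Round.supply i (suc j))

  f : Fin m → Fin n → Fin k
  f i j = proj₁ (choice i j)

  -- In each round a symbol has demand 1, shared between the dummy and the columns, so at most one
  -- column receives it.
  f-injective : ∀ i → Injective _≡_ _≡_ (f i)
  f-injective i = fibres≤1⇒injective (f i) λ ℓ → ≤-trans
    (≤-reflexive (sum-cong-≗ λ j → sym (proj₂ (choice i j) ℓ)))
    (≤-trans (m≤n+m _ (Y i zero ℓ)) (≤-reflexive (Round.demand i ℓ)))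

  f-fibres : ∀ j ℓ → ∑[ i < m ] δ (f i j) ℓ ≡ h j ℓ
  f-fibres j ℓ = trans (sum-cong-≗ λ i → sym (proj₂ (choice i j) ℓ)) (proj₂ (proj₂ rounds) (suc j) ℓ)

-- Completions

-- The boolean `not (does …)` is what `does (¬? …)` reduces to, so `μⱼ` and `μₖ` become sums of this
-- matrix by `if-∧`.
missing : Array r n k → Matrix n k
missing L j ℓ = if not (does (inColumn? L ℓ j)) then 1 else 0

-- A symbol occurs in a column once or is missing from it. This converts a capacity bound on the new
-- rows into a bound on the whole column, and back.
column-count : {L : Array r n k} → IsLatin L → ∀ j ℓ → ∑[ i < r ] δ (L i j) ℓ + missing L j ℓ ≡ 1
column-count {r} {L = L} latin j ℓ with inColumn? L ℓ j
... | yes (i , refl) = trans (+-identityʳ _) (≤-antisym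
  (injective⇒fibres≤1 (λ i → L i j) (IsLatin.columns latin j) ℓ)
  (≤-trans (≤-reflexive (sym (δ-refl ℓ))) (term≤sum (λ i → δ (L i j) ℓ) i)))
... | no absent = cong (_+ 1) (sum-zero {r} off)
  where
  off : ∀ i → δ (L i j) ℓ ≡ 0
  off i with L i j ≟ ℓ
  ... | yes eq = contradiction (i , eq) absent
  ... | no  _  = refl

sum-↑ : ∀ r {m} (f : Fin (r + m) → ℕ) →
  sum f ≡ ∑[ i < r ] f (i ↑ˡ m) + ∑[ i < m ] f (r ↑ʳ i)
sum-↑ zero    f = refl
sum-↑ (suc r) f = trans (cong (f zero +_) (sum-↑ r (f ∘ suc))) (sym (+-assoc (f zero) _ _))

inject≤≡↑ˡ : ∀ m (r≤n : r ≤ r + m) (i : Fin r) → inject≤ i r≤n ≡ i ↑ˡ m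
inject≤≡↑ˡ m r≤n i = toℕ-injective (trans (toℕ-inject≤ i r≤n) (sym (toℕ-↑ˡ i m)))

-- The transport tells which symbols each column still receives; `matchings` distributes them over
-- `m` new rows, placed below `L`. Matching `r + m ≡ n` with `refl` lets `splitAt r` separate old
-- rows from new ones.
transport⇒completable : {ρ : Fin k → ℕ} {L : Array r n k} → IsLatinRectangle ρ L → n ≤ k →
  r + m ≡ n → (r≤n : r ≤ n) → (∀ ℓ → deficit ρ L ℓ ≤ m) →
  ∃[ h ] IsTransport (λ _ → m) (deficit ρ L) (missing L) h → Completable ρ r≤n ≤-refl L
transport⇒completable {k} {r} {_} {m} {ρ} {L} rect n≤k refl r≤n d≤m (h , tr) =
  M , record { isLatin = record { rows = M-rows ; columns = M-columns } ; exactly = M-exactly } , extends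
  where
  open ≡-Reasoning
  open IsLatinRectangle rect
  open IsTransport tr
  N : ℕ
  N = r + m
  extension = matchings n≤k m (deficit ρ L) h d≤m supply demand
  f = proj₁ extension
  f-injective = proj₁ (proj₂ extension)
  f-fibres = proj₂ (proj₂ extension)

  M : Array N N k
  M i = [ L , f ]′ (splitAt r i)

  M-top : ∀ i → M (i ↑ˡ m) ≡ L i
  M-top i = cong [ L , f ]′ (splitAt-↑ˡ r i m)

  M-bottom : ∀ i → M (r ↑ʳ i) ≡ f i
  M-bottom i = cong [ L , f ]′ (splitAt-↑ʳ r m i)

  M-rows : ∀ i → Injective _≡_ _≡_ (λ j → M i j)
  M-rows i with splitAt r i
  ... | inj₁ i′ = IsLatin.rows isLatin i′
  ... | inj₂ i′ = f-injective i′

  M-sum : (g : (Fin N → Fin k) → ℕ) → ∑[ i < N ] g (M i) ≡ ∑[ i < r ] g (L i) + ∑[ i < m ] g (f i)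
  M-sum g = trans (sum-↑ r (λ i → g (M i)))
    (cong₂ _+_ (sum-cong-≗ λ i → cong g (M-top i)) (sum-cong-≗ λ i → cong g (M-bottom i)))

  -- The new rows use `ℓ` in column `j` at most `missing L j ℓ` times, so with the old rows the
  -- count is at most 1.
  M-columns : ∀ j → Injective _≡_ _≡_ (λ i → M i j)
  M-columns j = fibres≤1⇒injective (λ i → M i j) λ ℓ → ≤-trans
    (≤-reflexive (trans (M-sum (λ row → δ (row j) ℓ)) (cong (∑[ i < r ] δ (L i j) ℓ +_) (f-fibres j ℓ))))
    (≤-trans (+-monoʳ-≤ (∑[ i < r ] δ (L i j) ℓ) (capacity j ℓ))
             (≤-reflexive (column-count isLatin j ℓ)))

  M-exactly : ∀ ℓ → occurrences M ℓ ≡ ρ ℓ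
  M-exactly ℓ = begin
    occurrences M ℓ
      ≡⟨ M-sum (λ row → ∑[ j < N ] δ (row j) ℓ) ⟩
    occurrences L ℓ + ∑[ i < m ] ∑[ j < N ] δ (f i j) ℓ
      ≡⟨ cong (occurrences L ℓ +_) (∑-comm (λ i j → δ (f i j) ℓ)) ⟩
    occurrences L ℓ + ∑[ j < N ] ∑[ i < m ] δ (f i j) ℓ
      ≡⟨ cong (occurrences L ℓ +_) (trans (sum-cong-≗ λ j → f-fibres j ℓ) (demand ℓ)) ⟩
    occurrences L ℓ + deficit ρ L ℓ
      ≡⟨ m+[n∸m]≡n (atMost ℓ) ⟩
    ρ ℓ ∎

  extends : ∀ i j → M (inject≤ i r≤n) (inject≤ j ≤-refl) ≡ L i j
  extends i j = trans (cong₂ M (inject≤≡↑ˡ m r≤n i) (inject≤-refl j ≤-refl)) (cong (λ row → row j) (M-top i))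

-- The matrix `h` counts each symbol in each column among the new rows, forgetting their order. The
-- deficit bound holds because each of the `m` new rows contains a symbol at most once.
completable⇒transport : {ρ : Fin k → ℕ} {L : Array r n k} → IsLatinRectangle ρ L →
  r + m ≡ n → (r≤n : r ≤ n) → Completable ρ r≤n ≤-refl L →
  (∀ ℓ → deficit ρ L ℓ ≤ m) × (∃[ h ] IsTransport (λ _ → m) (deficit ρ L) (missing L) h)
completable⇒transport {k} {r} {_} {m} {ρ} {L} rect refl r≤n (M , square , extends) =
  d≤m , h , record { capacity = h≤missing ; supply = h-rows ; demand = h-columns }
  where
  open ≡-Reasoning
  module Rect = IsLatinRectangle rect
  module Square = IsLatinSquare square
  N : ℕ
  N = r + m

  h : Matrix N k
  h j ℓ = ∑[ i < m ] δ (M (r ↑ʳ i) j) ℓ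

  M-top : ∀ i j → M (i ↑ˡ m) j ≡ L i j
  M-top i j = trans (sym (cong₂ M (inject≤≡↑ˡ m r≤n i) (inject≤-refl j ≤-refl))) (extends i j)

  h-rows : ∀ j → ∑[ ℓ < k ] h j ℓ ≡ m
  h-rows j = begin
    ∑[ ℓ < k ] ∑[ i < m ] δ (M (r ↑ʳ i) j) ℓ  ≡⟨ ∑-comm (λ ℓ i → δ (M (r ↑ʳ i) j) ℓ) ⟩
    ∑[ i < m ] sum (δ (M (r ↑ʳ i) j))         ≡⟨ sum-cong-≗ (λ i → sum-δ (M (r ↑ʳ i) j)) ⟩
    ∑[ i < m ] 1                              ≡⟨ trans (sum-const m 1) (*-identityʳ m) ⟩
    m                                         ∎

  bottom : ∀ ℓ → ∑[ i < m ] ∑[ j < N ] δ (M (r ↑ʳ i) j) ℓ ≡ deficit ρ L ℓ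
  -- Adding the occurrences in `L` completes the count to all of `M`, where it is `ρ ℓ`.
  bottom ℓ = begin
    below                                         ≡⟨ m+n∸m≡n (occurrences L ℓ) below ⟨
    (occurrences L ℓ + below) ∸ occurrences L ℓ   ≡⟨ cong (_∸ occurrences L ℓ) (begin
      occurrences L ℓ + below
        ≡⟨ cong (_+ below) (sum-cong-≗ λ i → sum-cong-≗ λ j → cong (λ s → δ s ℓ) (M-top i j)) ⟨
      ∑[ i < r ] ∑[ j < N ] δ (M (i ↑ˡ m) j) ℓ + below
        ≡⟨ sum-↑ r (λ i → ∑[ j < N ] δ (M i j) ℓ) ⟨
      occurrences M ℓ
        ≡⟨ Square.exactly ℓ ⟩
      ρ ℓ ∎) ⟩
    deficit ρ L ℓ                                 ∎
    where below = ∑[ i < m ] ∑[ j < N ] δ (M (r ↑ʳ i) j) ℓ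

  h-columns : ∀ ℓ → ∑[ j < N ] h j ℓ ≡ deficit ρ L ℓ
  h-columns ℓ = trans (∑-comm (λ j i → δ (M (r ↑ʳ i) j) ℓ)) (bottom ℓ)

  d≤m : ∀ ℓ → deficit ρ L ℓ ≤ m
  d≤m ℓ = ≤-trans (≤-reflexive (sym (bottom ℓ)))
    (≤-trans (sum-mono λ i → injective⇒fibres≤1 (M (r ↑ʳ i)) (IsLatin.rows Square.isLatin (r ↑ʳ i)) ℓ)
             (≤-reflexive (trans (sum-const m 1) (*-identityʳ m))))

  -- The whole column of `M` contains `ℓ` at most once, and `column-count` writes that 1 as the old
  -- occurrences plus `missing L j ℓ`.
  h≤missing : ∀ j ℓ → h j ℓ ≤ missing L j ℓ
  h≤missing j ℓ = +-cancelˡ-≤ (∑[ i < r ] δ (L i j) ℓ) _ _ (≤-trans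
    (≤-reflexive (trans
      (cong (_+ h j ℓ) (sum-cong-≗ λ i → cong (λ s → δ s ℓ) (sym (M-top i j))))
      (sym (sum-↑ r (λ i → δ (M i j) ℓ)))))
    (≤-trans (injective⇒fibres≤1 (λ i → M i j) (IsLatin.columns Square.isLatin j) ℓ)
             (≤-reflexive (sym (column-count Rect.isLatin j ℓ)))))

-- The six conditions

balance : ∀ {s t u v} → s + t ≡ u + v → s ≤ u → v ≤ t
balance {s} {t} {u} {v} s+t≡u+v s≤u =
  +-cancelˡ-≤ u v t (≤-trans (≤-reflexive (sym s+t≡u+v)) (+-monoˡ-≤ t s≤u))

module _ {p q : ℕ} (a : Fin p → ℕ) (b : Fin q → ℕ) (c : Matrix p q) where

  -- General margins allow this form to serve for subsets of symbols too, after exchanging `a` with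
  -- `b` and flipping `c`; likewise for `ExcessCondition`.
  MinimumCondition : Set
  MinimumCondition = ∀ J → sumOver J a ≤ ∑[ ℓ < q ] (b ℓ ⊓ sumOver J (λ j → c j ℓ))

  ExcessCondition : Set
  ExcessCondition = ∀ J → ∑[ ℓ < q ] (b ℓ ∸ sumOver (∁ J) (λ j → c j ℓ)) ≤ sumOver J a

  private
    out : Subset p → Fin q → ℕ
    out J ℓ = sumOver J (λ j → c j ℓ)

  -- For fixed J, the best K collects the ℓ with b ℓ ≤ out J ℓ.
  minimum⇔cut : MinimumCondition ⇔ CutCondition a b c
  minimum⇔cut = mk⇔
    (λ minimum J K → ≤-trans (minimum J) (≤-trans
      (sum-mono λ ℓ → bound (does (ℓ ∈? K)) (b ℓ) (out J ℓ))
      (≤-reflexive (sumOver-split K b (out J)))))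
    (λ cut J → ≤-trans (cut J (best J)) (≤-reflexive (trans
      (sym (sumOver-split (best J) b (out J)))
      (sum-cong-≗ λ ℓ → trans
        (cong (if_then b ℓ else out J ℓ) (∈?-tabulate (λ ℓ → b ℓ ≤ᵇ out J ℓ) ℓ))
        (attained (b ℓ) (out J ℓ))))))
    where
    best : Subset p → Subset q
    best J = tabulate (λ ℓ → b ℓ ≤ᵇ out J ℓ)
    bound : ∀ v x y → x ⊓ y ≤ (if v then x else y)
    bound true  x y = m⊓n≤m x y
    bound false x y = m⊓n≤n x y
    attained : ∀ x y → (if x ≤ᵇ y then x else y) ≡ x ⊓ y
    attained x y with x ≤ᵇ y in x≤ᵇy
    ... | true  = sym (m≤n⇒m⊓n≡m (≤ᵇ⇒≤ x y (subst T (sym x≤ᵇy) _)))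
    ... | false = sym (m≥n⇒m⊓n≡n (<⇒≤ (≰⇒> λ x≤y → subst T x≤ᵇy (≤⇒≤ᵇ x≤y))))

  -- Each `b ℓ` splits into its excess over `out (∁ J) ℓ` and its minimum with it. With equal
  -- totals, the excess bound at `J` is therefore the minimum bound at `∁ J`.
  excess⇔minimum : sum a ≡ sum b → ExcessCondition ⇔ MinimumCondition
  excess⇔minimum a≡b = mk⇔
    (λ excess J → subst (λ S → sumOver S a ≤ minimum S) (∁-involutive J)
      (balance (totals (∁ J)) (excess (∁ J))))
    (λ minimumBound J → balance (trans (+-comm (sumOver (∁ J) a) _)
      (trans (sym (totals J)) (+-comm _ (minimum (∁ J))))) (minimumBound (∁ J)))
    where
    minimum : Subset p → ℕ
    minimum S = ∑[ ℓ < q ] (b ℓ ⊓ out S ℓ)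
    totals : ∀ J → ∑[ ℓ < q ] (b ℓ ∸ out (∁ J) ℓ) + minimum (∁ J) ≡ sumOver J a + sumOver (∁ J) a
    totals J = begin
      ∑[ ℓ < q ] (b ℓ ∸ out (∁ J) ℓ) + minimum (∁ J)
        ≡⟨ ∑-distrib-+ (λ ℓ → b ℓ ∸ out (∁ J) ℓ) _ ⟨
      ∑[ ℓ < q ] (b ℓ ∸ out (∁ J) ℓ + b ℓ ⊓ out (∁ J) ℓ)
        ≡⟨ sum-cong-≗ (λ ℓ → trans (+-comm (b ℓ ∸ out (∁ J) ℓ) _)
             (trans (cong (_+ (b ℓ ∸ out (∁ J) ℓ)) (⊓-comm (b ℓ) _)) (m⊓n+n∸m≡n (out (∁ J) ℓ) (b ℓ)))) ⟩
      sum b                          ≡⟨ a≡b ⟨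
      sum a                          ≡⟨ sumOver-∁ J a ⟨
      sumOver J a + sumOver (∁ J) a  ∎
      where open ≡-Reasoning

-- The given condition is applied to the complements `∁ J`, `∁ K`. The edges crossing there run
-- between `∁ J` and `K`, as they do in the transposed cut, and equal totals exchange the
-- complementary sums.
cut-transpose : {a : Fin p → ℕ} {b : Fin q → ℕ} {c : Matrix p q} → sum a ≡ sum b →
  CutCondition a b c → CutCondition b a (flip c)
cut-transpose {a = a} {b} {c} a≡b cut K J = +-cancelˡ-≤ (sumOver (∁ J) a) _ _ (begin
  sumOver (∁ J) a + sumOver K b
    ≤⟨ +-monoˡ-≤ (sumOver K b) (cut (∁ J) (∁ K)) ⟩
  sumOver (∁ K) b + crossing c (∁ J) (∁ K) + sumOver K b
    ≡⟨ cong (λ t → sumOver (∁ K) b + t + sumOver K b) (trans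
         (cong (λ S → sumOver S (λ ℓ → sumOver (∁ J) (λ j → c j ℓ))) (∁-involutive K))
         (sumOver-comm K (∁ J) (flip c))) ⟩
  sumOver (∁ K) b + crossing (flip c) K J + sumOver K b
    ≡⟨ rearrange (sumOver (∁ K) b) (crossing (flip c) K J) (sumOver K b) ⟩
  (sumOver K b + sumOver (∁ K) b) + crossing (flip c) K J
    ≡⟨ cong (_+ crossing (flip c) K J)
         (trans (sumOver-∁ K b) (trans (sym a≡b) (sym (sumOver-∁ J a)))) ⟩
  (sumOver J a + sumOver (∁ J) a) + crossing (flip c) K J
    ≡⟨ swap (sumOver J a) (sumOver (∁ J) a) (crossing (flip c) K J) ⟩
  sumOver (∁ J) a + (sumOver J a + crossing (flip c) K J) ∎)
  where
  open ≤-Reasoning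
  rearrange : ∀ x y z → x + y + z ≡ (z + x) + y
  rearrange = solve-∀
  swap : ∀ x y z → (x + y) + z ≡ y + (x + z)
  swap = solve-∀

cut⇔transpose : {a : Fin p → ℕ} {b : Fin q → ℕ} {c : Matrix p q} → sum a ≡ sum b →
  CutCondition a b c ⇔ CutCondition b a (flip c)
cut⇔transpose a≡b = mk⇔ (cut-transpose a≡b) (cut-transpose (sym a≡b))

∀-≤-cong : {A : Set} {f f′ g g′ : A → ℕ} → (∀ x → f x ≡ f′ x) → (∀ x → g x ≡ g′ x) →
  (∀ x → f x ≤ g x) ⇔ (∀ x → f′ x ≤ g′ x)
∀-≤-cong f≗ g≗ = mk⇔
  (λ f≤g x → subst₂ _≤_ (f≗ x) (g≗ x) (f≤g x))
  (λ f≤g x → subst₂ _≤_ (sym (f≗ x)) (sym (g≗ x)) (f≤g x))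

-- The rectangle fills `r * n` of the `n * n` cells that `ρ` accounts for. This provides the
-- equality of total supply and total demand.
sum-deficit : {ρ : Fin k → ℕ} {L : Array r n k} → (∀ ℓ → occurrences L ℓ ≤ ρ ℓ) →
  sum ρ ≡ n ^ 2 → r ≤ n → sum (deficit ρ L) ≡ n * (n ∸ r)
sum-deficit {k} {r} {n} {ρ} {L} atMost ρ-sum r≤n = +-cancelʳ-≡ (n * r) _ _ (begin
  sum (deficit ρ L) + n * r                ≡⟨ cong (sum (deficit ρ L) +_) (trans (*-comm n r) (sym cells)) ⟩
  sum (deficit ρ L) + sum (occurrences L)  ≡⟨ sum-∸ ρ (occurrences L) atMost ⟩
  sum ρ                                    ≡⟨ ρ-sum ⟩
  n ^ 2                                    ≡⟨ cong (n *_) (*-identityʳ n) ⟩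
  n * n                                    ≡⟨ cong (n *_) (m∸n+n≡m r≤n) ⟨
  n * (n ∸ r + r)                          ≡⟨ *-distribˡ-+ n (n ∸ r) r ⟩
  n * (n ∸ r) + n * r                      ∎)
  where
  open ≡-Reasoning
  cells : sum (occurrences L) ≡ r * n
  cells = begin
    ∑[ ℓ < k ] ∑[ i < r ] ∑[ j < n ] δ (L i j) ℓ
      ≡⟨ ∑-comm (λ ℓ i → ∑[ j < n ] δ (L i j) ℓ) ⟩
    ∑[ i < r ] ∑[ ℓ < k ] ∑[ j < n ] δ (L i j) ℓ
      ≡⟨ sum-cong-≗ (λ i → trans (∑-comm (λ ℓ j → δ (L i j) ℓ)) (trans
           (sum-cong-≗ λ j → sum-δ (L i j)) (trans (sum-const n 1) (*-identityʳ n)))) ⟩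
    ∑[ i < r ] n
      ≡⟨ sum-const r n ⟩
    r * n ∎

-- All six conditions are compared with one cut condition: `0F`, `2F` and `4F` directly, and `1F`,
-- `3F` and `5F` through the transposed problem.
condition⇔cut : (ρ : Fin k → ℕ) (L : Array r n k) → sum (deficit ρ L) ≡ n * (n ∸ r) → ∀ c →
  Conditions.Condition ρ L c ⇔ CutCondition (λ _ → n ∸ r) (deficit ρ L) (missing L)
condition⇔cut {k} {r} {n} ρ L d-sum = equivalent
  where
  open Conditions ρ L hiding (deficit)
  a : Fin n → ℕ
  a _ = n ∸ r
  d : Fin k → ℕ
  d = deficit ρ L
  c : Matrix n k
  c = missing L

  a≡d : sum a ≡ sum d
  a≡d = trans (sum-const n (n ∸ r)) (sym d-sum)
  d≡a : sum d ≡ sum a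
  d≡a = sym a≡d

  size≡ : ∀ J → ∣ J ∣ * (n ∸ r) ≡ sumOver J a
  size≡ J = sym (sumOver-const J (n ∸ r))

  μⱼ≡ : ∀ J ℓ → μⱼ J ℓ ≡ sumOver J (λ j → c j ℓ)
  μⱼ≡ J ℓ = sum-cong-≗ λ j → if-∧ (does (j ∈? J))

  μₖ≡ : ∀ K j → μₖ K j ≡ sumOver K (c j)
  μₖ≡ K j = sum-cong-≗ λ ℓ → if-∧ (does (ℓ ∈? K))

  equivalent : ∀ i → Condition i ⇔ CutCondition a d c
  equivalent 0F = minimum⇔cut a d c ⇔-∘
    ∀-≤-cong size≡ (λ J → sum-cong-≗ λ ℓ → cong (d ℓ ⊓_) (μⱼ≡ J ℓ))
  equivalent 1F = cut⇔transpose d≡a ⇔-∘ (minimum⇔cut d a (flip c) ⇔-∘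
    ∀-≤-cong (λ K → refl) (λ K → sum-cong-≗ λ j → cong ((n ∸ r) ⊓_) (μₖ≡ K j)))
  equivalent 2F = minimum⇔cut a d c ⇔-∘ (excess⇔minimum a d c a≡d ⇔-∘
    ∀-≤-cong (λ J → sum-cong-≗ λ ℓ → cong (d ℓ ∸_) (μⱼ≡ (∁ J) ℓ)) size≡)
  equivalent 3F = cut⇔transpose d≡a ⇔-∘ (minimum⇔cut d a (flip c) ⇔-∘
    (excess⇔minimum d a (flip c) d≡a ⇔-∘
    ∀-≤-cong (λ K → sum-cong-≗ λ j → cong ((n ∸ r) ∸_) (μₖ≡ (∁ K) j)) (λ K → refl)))
  equivalent 4F = mk⇔
    (λ cond J K → subst₂ _≤_ (size≡ J) (right J K) (cond J K))
    (λ cut J K → subst₂ _≤_ (sym (size≡ J)) (sym (right J K)) (cut J K))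
    where
    right : ∀ J K → sumOver K d + sumOver (∁ K) (μⱼ J) ≡ sumOver K d + crossing c J K
    right J K = cong (sumOver K d +_) (sumOver-cong (∁ K) (μⱼ≡ J))
  -- The transposed cut condition takes `K` before `J`, so the quantifiers are exchanged here.
  equivalent 5F = cut⇔transpose d≡a ⇔-∘ mk⇔
    (λ cond K J → subst (sumOver K d ≤_) (right J K) (cond J K))
    (λ cut J K → subst (sumOver K d ≤_) (sym (right J K)) (cut K J))
    where
    right : ∀ J K → ∣ J ∣ * (n ∸ r) + sumOver (∁ J) (μₖ K) ≡ sumOver J a + crossing (flip c) K J
    right J K = cong₂ _+_ (size≡ J) (sumOver-cong (∁ J) (μₖ≡ K))

theorem3p1 : ∀ (n k r : ℕ) (ρ : Fin k → ℕ) → Admissible n k ρ →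
    (r<n : r < n) (L : Array r n k) → IsLatinRectangle ρ L →
    let open Conditions ρ L in
    (Completable ρ (<⇒≤ r<n) ≤-refl L ⇔ (DeficitBound × (∃[ c ] Condition c)))
    × (DeficitBound → ∀ c c′ → Condition c → Condition c′)
theorem3p1 n k r ρ admissible r<n L rect =
  mk⇔
    (λ completable →
      let d≤m , h , tr = completable⇒transport rect r+m≡n r≤n completable
      -- Condition `4F` is chosen as the witness because it is the cut condition up to notation.
      in d≤m , 4F , from (cut 4F) (transport⇒cut tr))
    (λ (d≤m , i , condition) →
      transport⇒completable rect n≤k r+m≡n r≤n d≤m
        (cut⇒transport (λ _ → n ∸ r) (deficit ρ L) (missing L)
          (trans (sum-const n (n ∸ r)) (sym d-sum)) (to (cut i) condition)))
  , λ _ i i′ condition → from (cut i′) (to (cut i) condition)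
  where
  open Admissible admissible
  open Equivalence
  r≤n = <⇒≤ r<n
  r+m≡n = m+[n∸m]≡n r≤n
  d-sum = sum-deficit {L = L} (IsLatinRectangle.atMost rect) ρ-sum r≤n
  cut = condition⇔cut ρ L d-sum
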